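{- For every formula $\varphi\in\mathcal L$: (i) $\varphi$ is valid on all $\mathsf{CS4}$-models if and only if $\kappa(\varphi)$ is valid on all $\mathsf{CK}$-models; and (ii) $\varphi$ is valid on all $\mathsf{WS4}$-models if and only if $\kappa(\varphi)$ is valid on all $\mathsf{WK}$-models.
   Context: Language. Let $\mathrm{Prop}$ be a set of proposition symbols. $\mathcal L^*$ is given by $\varphi ::= \bot \mid p\mid \varphi\land\varphi \mid \varphi\lor\varphi \mid \varphi\to\varphi \mid \Box\varphi \mid \Diamond\varphi \mid \Box^*\varphi \mid \Diamond^*\varphi$, with $p\in\mathrm{Prop}$. $\mathcal L$ is the fragment of $\mathcal L^*$ without $\Box^*$ and $\Diamond^*$. Relations. $(R;S)$ is composition: $x(R;S)y$ iff there is $z$ with $xRz$ and $zSy$. $R^*$ is the reflexive-transitive closure of $R$. Models. A $\mathsf{CK}$-frame is a tuple $(W,\preccurlyeq,R)$ where $\preccurlyeq$ is a preorder on $W$ and $R$ is any binary relation on $W$. A $\mathsf{CK}$-model is $\mathcal M=(W,\preccurlyeq,R,\|\cdot\|)$, a $\mathsf{CK}$-frame with a map $\|\cdot\|:\mathrm{Prop}\cup\{\bot\}\to\mathcal P(W)$ such that for all $p\in\mathrm{Prop}$: (1) $\|\bot\|\subseteq\|p\|$; (2) if $w\preccurlyeq v$ and $w\in\|p\|$ then $v\in\|p\|$; (3) if $w\in\|\bot\|$ and ($w\preccurlyeq v$ or $wRv$) then $v\in\|\bot\|$; (4) if $w\in\|\bot\|$ then there is $v$ with $wRv$. A $\mathsf{WK}$-model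 is a $\mathsf{CK}$-model with $\|\bot\|=\varnothing$. A $\mathsf{CS4}$-frame is a $\mathsf{CK}$-frame in which $R$ is a preorder and which is confluent: $wRv\preccurlyeq v'$ implies there is $w'$ with $w\preccurlyeq w'Rv'$. A $\mathsf{CS4}$-model is a $\mathsf{CK}$-model whose frame is a $\mathsf{CS4}$-frame. A $\mathsf{WS4}$-model is a $\mathsf{CS4}$-model with $\|\bot\|=\varnothing$. Satisfaction. $(\mathcal M,w)\Vdash\bot$ iff $w\in\|\bot\|$; $(\mathcal M,w)\Vdash p$ iff $w\in\|p\|$; $\wedge,\vee$ are interpreted pointwise as usual; $(\mathcal M,w)\Vdash\varphi\to\psi$ iff for all $v\succcurlyeq w$, $(\mathcal M,v)\Vdash\varphi$ implies $(\mathcal M,v)\Vdash\psi$; $(\mathcal M,w)\Vdash\Box\varphi$ iff $(\mathcal M,v)\Vdash\varphi$ for all $v$ with $w(\preccurlyeq;R)v$; $(\mathcal M,w)\Vdash\Diamond\varphi$ iff for all $v\succcurlyeq w$ there is $u$ with $vRu$ and $(\mathcal M,u)\Vdash\varphi$; $(\mathcal M,w)\Vdash\Box^*\varphi$ iff $(\mathcal M,v)\Vdash\varphi$ for all $v$ with $w(\preccurlyeq;R)^*v$; $(\mathcal M,w)\Vdash\Diamond^*\varphi$ iff for all $v\succcurlyeq w$ there is $u$ with $vR^*u$ and $(\mathcal M,u)\Vdash\varphi$. A formula is valid on a model if it is satisfied at all its worlds. Translation. $\kappa(\varphi)$ is the result of replacing every $\Box$ in $\varphi$ by $\Box^*$ and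 every $\Diamond$ by $\Diamond^*$. -}

module Defs where

open import Data.Product using (∃; _×_)
open import Data.Sum using (_⊎_)
open import Level using (Level; _⊔_; suc)
open import Relation.Binary using (Rel; IsPreorder)
open import Relation.Binary.Construct.Closure.ReflexiveTransitive using (Star)
open import Relation.Binary.Construct.Composition using (_;_)
open import Relation.Binary.PropositionalEquality using (_≡_)
open import Relation.Unary using (Pred; Empty; _⊆_; _∈_)

private
  variable
    p ℓ : Level

infix  9 □_ ◇_ □*_ ◇*_
infixr 8 _∧_
infixr 7 _∨_
infixr 6 _⇒_

-- The language 𝓛*, over the proposition symbols PV.
data Form (PV : Set p) : Set p where
  bot             : Form PV
  atom            : PV → Form PV
  _∧_ _∨_ _⇒_     : Form PV → Form PV → Form PV
  □_ ◇_ □*_ ◇*_   : Form PV → Form PV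

-- The fragment 𝓛: formulas in which neither □* nor ◇* occurs.
data 𝓛 {PV : Set p} : Pred (Form PV) p where
  bot  : 𝓛 bot
  atom : ∀ q → 𝓛 (atom q)
  _∧_  : ∀ {φ ψ} → 𝓛 φ → 𝓛 ψ → 𝓛 (φ ∧ ψ)
  _∨_  : ∀ {φ ψ} → 𝓛 φ → 𝓛 ψ → 𝓛 (φ ∨ ψ)
  _⇒_  : ∀ {φ ψ} → 𝓛 φ → 𝓛 ψ → 𝓛 (φ ⇒ ψ)
  □_   : ∀ {φ} → 𝓛 φ → 𝓛 (□ φ)
  ◇_   : ∀ {φ} → 𝓛 φ → 𝓛 (◇ φ)

κ : {PV : Set p} → Form PV → Form PV
κ bot      = bot
κ (atom q) = atom q
κ (φ ∧ ψ)  = κ φ ∧ κ ψ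
κ (φ ∨ ψ)  = κ φ ∨ κ ψ
κ (φ ⇒ ψ)  = κ φ ⇒ κ ψ
κ (□ φ)    = □* κ φ
κ (◇ φ)    = ◇* κ φ
κ (□* φ)   = □* κ φ
κ (◇* φ)   = ◇* κ φ

record CKFrame (ℓ : Level) : Set (suc ℓ) where
  infix 4 _≼_
  field
    W            : Set ℓ
    _≼_          : Rel W ℓ
    R            : Rel W ℓ
    ≼-isPreorder : IsPreorder _≡_ _≼_

record IsCS4Frame (F : CKFrame ℓ) : Set ℓ where
  open CKFrame F
  field
    R-isPreorder : IsPreorder _≡_ R
    confluent    : ∀ {w v v′} → R w v → v ≼ v′ → ∃ λ w′ → w ≼ w′ × R w′ v′

-- The valuation Prop ∪ {⊥} → 𝒫(W) is split into its restriction ‖_‖ to Prop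
-- and its value ‖⊥‖ at ⊥, the set of fallible worlds.
record CKModel (PV : Set p) (ℓ : Level) : Set (p ⊔ suc ℓ) where
  field
    frame : CKFrame ℓ
  open CKFrame frame public
  field
    ‖⊥‖           : Pred W ℓ
    ‖_‖           : PV → Pred W ℓ
    ‖⊥‖⊆‖_‖       : ∀ q → ‖⊥‖ ⊆ ‖ q ‖
    ‖_‖-monotone  : ∀ q {w v} → w ≼ v → w ∈ ‖ q ‖ → v ∈ ‖ q ‖
    ‖⊥‖-closed    : ∀ {w v} → w ∈ ‖⊥‖ → w ≼ v ⊎ R w v → v ∈ ‖⊥‖
    ‖⊥‖-serial    : ∀ {w} → w ∈ ‖⊥‖ → ∃ λ v → R w v

module _ {PV : Set p} where

  IsWK : CKModel PV ℓ → Set ℓ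
  IsWK M = Empty (CKModel.‖⊥‖ M)

  IsCS4 : CKModel PV ℓ → Set ℓ
  IsCS4 M = IsCS4Frame (CKModel.frame M)

  IsWS4 : CKModel PV ℓ → Set ℓ
  IsWS4 M = IsCS4 M × IsWK M

  infix 4 _,_⊩_ _⊨_

  _,_⊩_ : (M : CKModel PV ℓ) → CKModel.W M → Form PV → Set ℓ
  M , w ⊩ bot    = w ∈ CKModel.‖⊥‖ M
  M , w ⊩ atom q = w ∈ CKModel.‖_‖ M q
  M , w ⊩ φ ∧ ψ  = M , w ⊩ φ × M , w ⊩ ψ
  M , w ⊩ φ ∨ ψ  = M , w ⊩ φ ⊎ M , w ⊩ ψ
  M , w ⊩ φ ⇒ ψ  = let open CKModel M in
    ∀ v → w ≼ v → M , v ⊩ φ → M , v ⊩ ψ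
  M , w ⊩ □ φ    = let open CKModel M in
    ∀ v → (_≼_ ; R) w v → M , v ⊩ φ
  M , w ⊩ ◇ φ    = let open CKModel M in
    ∀ v → w ≼ v → ∃ λ u → R v u × M , u ⊩ φ
  M , w ⊩ □* φ   = let open CKModel M in
    ∀ v → Star (_≼_ ; R) w v → M , v ⊩ φ
  M , w ⊩ ◇* φ   = let open CKModel M in
    ∀ v → w ≼ v → ∃ λ u → Star R v u × M , u ⊩ φ

  _⊨_ : CKModel PV ℓ → Form PV → Set ℓ
  M ⊨ φ = ∀ w → M , w ⊩ φ

{-# OPTIONS --safe #-}

-- On a CS4-model, R* = R and, by confluence, (≼;R)* = ≼;R, so φ and κ φ agree.
-- Conversely, a CK-model M is turned into a CS4-model by splitting each world w
-- into two ≼-equivalent copies. The narrow copy sees the narrow copies of the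
-- R*-successors of w; the wide copy sees both copies of every world reachable
-- by (≼;R)*;≼. The wide copies restore confluence. They leave ◇ unchanged
-- because the narrow copy, which has fewer successors, lies above the wide one,
-- and □ unchanged because truth is preserved along ≼.

module Submission where

open import Defs
open import Data.Bool using (Bool; true; false)
open import Data.Product using (_×_; _,_; proj₁; map; map₂)
open import Data.Product.Function.NonDependent.Propositional using (_×-⇔_)
open import Data.Sum using (inj₁; inj₂; [_,_])
open import Data.Sum.Function.Propositional using (_⊎-⇔_)
open import Function using (_∘_; _on_)
open import Function.Bundles using (_⇔_; mk⇔; Equivalence)
open import Function.Properties.Equivalence using () renaming (refl to ⇔-refl)
open import Level using (Level)
open import Relation.Binary using (Rel; IsPreorder)
open import Relation.Binary.Construct.Closure.ReflexiveTransitive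
  using (Star; ε; _◅_; _◅◅_; fold)
open import Relation.Binary.Construct.Composition using (_;_)
open import Relation.Binary.PropositionalEquality using (refl; isEquivalence)
open import Relation.Unary using (_∈_)

open Equivalence using (to; from)

private
  variable
    p ℓ : Level
    PV : Set p

module _ (M : CKModel PV ℓ) where
  open CKModel M
  private module ≼ = IsPreorder ≼-isPreorder

  ⊩-monotone : ∀ φ {w v} → w ≼ v → M , w ⊩ φ → M , v ⊩ φ
  ⊩-monotone bot      w≼v h             = ‖⊥‖-closed h (inj₁ w≼v)
  ⊩-monotone (atom q) w≼v h             = ‖_‖-monotone q w≼v h
  ⊩-monotone (φ ∧ ψ)  w≼v (h , k)       = ⊩-monotone φ w≼v h , ⊩-monotone ψ w≼v k
  ⊩-monotone (φ ∨ ψ)  w≼v (inj₁ h)      = inj₁ (⊩-monotone φ w≼v h)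
  ⊩-monotone (φ ∨ ψ)  w≼v (inj₂ h)      = inj₂ (⊩-monotone ψ w≼v h)
  ⊩-monotone (φ ⇒ ψ)  w≼v h u v≼u       = h u (≼.trans w≼v v≼u)
  ⊩-monotone (□ φ)    w≼v h u (x , v≼x , xRu) = h u (x , ≼.trans w≼v v≼x , xRu)
  ⊩-monotone (◇ φ)    w≼v h u v≼u       = h u (≼.trans w≼v v≼u)
  -- The empty path has no leading `≼` to absorb `w≼v`, so this case falls back on induction; a
  -- nonempty path absorbs it in its first step.
  ⊩-monotone (□* φ)   w≼v h u ε         = ⊩-monotone φ w≼v (h _ ε)
  ⊩-monotone (□* φ)   w≼v h u ((x , v≼x , xRy) ◅ y↠u) =
    h u ((x , ≼.trans w≼v v≼x , xRy) ◅ y↠u)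
  ⊩-monotone (◇* φ)   w≼v h u v≼u       = h u (≼.trans w≼v v≼u)

module _ (M : CKModel PV ℓ) (cs4 : IsCS4 M) where
  open CKModel M
  open IsCS4Frame cs4
  private
    module ≼ = IsPreorder ≼-isPreorder
    module R = IsPreorder R-isPreorder

  Star-R⇒R : ∀ {w v} → Star R w v → R w v
  Star-R⇒R = fold R R.trans R.refl

  Star-≼;R⇒≼;R : ∀ {w v} → Star (_≼_ ; R) w v → (_≼_ ; R) w v
  Star-≼;R⇒≼;R = fold (_≼_ ; R) merge (_ , ≼.refl , R.refl)
    where
    merge : ∀ {w u v} → (_≼_ ; R) w u → (_≼_ ; R) u v → (_≼_ ; R) w v
    merge (_ , w≼x , xRu) (_ , u≼y , yRv) =
      -- Confluence turns the middle `R ; ≼` into `≼ ; R`; transitivity then merges both ends.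
      let x′ , x≼x′ , x′Ry = confluent xRu u≼y
      in x′ , ≼.trans w≼x x≼x′ , R.trans x′Ry yRv

  CS4-⊩⇔⊩κ : ∀ {φ} → 𝓛 φ → ∀ w → M , w ⊩ φ ⇔ M , w ⊩ κ φ
  CS4-⊩⇔⊩κ bot      w = ⇔-refl
  CS4-⊩⇔⊩κ (atom q) w = ⇔-refl
  CS4-⊩⇔⊩κ (a ∧ b)  w = CS4-⊩⇔⊩κ a w ×-⇔ CS4-⊩⇔⊩κ b w
  CS4-⊩⇔⊩κ (a ∨ b)  w = CS4-⊩⇔⊩κ a w ⊎-⇔ CS4-⊩⇔⊩κ b w
  CS4-⊩⇔⊩κ (a ⇒ b)  w = mk⇔
    (λ h v w≼v → to   (CS4-⊩⇔⊩κ b v) ∘ h v w≼v ∘ from (CS4-⊩⇔⊩κ a v))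
    (λ h v w≼v → from (CS4-⊩⇔⊩κ b v) ∘ h v w≼v ∘ to   (CS4-⊩⇔⊩κ a v))
  CS4-⊩⇔⊩κ (□ a)    w = mk⇔
    (λ h v w↠v → to   (CS4-⊩⇔⊩κ a v) (h v (Star-≼;R⇒≼;R w↠v)))
    (λ h v w→v → from (CS4-⊩⇔⊩κ a v) (h v (w→v ◅ ε)))
  CS4-⊩⇔⊩κ (◇ a)    w = mk⇔
    (λ h v w≼v → map₂ (λ {u} → map (_◅ ε) (to (CS4-⊩⇔⊩κ a u))) (h v w≼v))
    (λ h v w≼v → map₂ (λ {u} → map Star-R⇒R (from (CS4-⊩⇔⊩κ a u))) (h v w≼v))

module Split (M : CKModel PV ℓ) where
  open CKModel M
  private module ≼ = IsPreorder ≼-isPreorder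

  -- This is the reflexive-transitive closure of the union of `≼` and `R`. The trailing `≼` closes
  -- it under `≼` on the right, as confluence demands.
  Reach : Rel W ℓ
  Reach = Star (_≼_ ; R) ; _≼_

  data R± : Rel (W × Bool) ℓ where
    narrow : ∀ {w v} → Star R w v → R± (w , false) (v , false)
    wide   : ∀ {w v i} → Reach w v → R± (w , true) (v , i)

  Star-R⇒Star-≼;R : ∀ {w v} → Star R w v → Star (_≼_ ; R) w v
  Star-R⇒Star-≼;R = fold _ (λ wRu u↠v → (_ , ≼.refl , wRu) ◅ u↠v) ε

  -- The extra `≼` merges into the first step of the path, or into the trailing `≼` if the path is
  -- empty.
  ≼-Reach : ∀ {w v u} → w ≼ v → Reach v u → Reach w u
  ≼-Reach w≼v (_ , ε , v≼u) = _ , ε , ≼.trans w≼v v≼u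
  ≼-Reach w≼v (_ , (_ , v≼x , xRy) ◅ y↠z , z≼u) =
    _ , (_ , ≼.trans w≼v v≼x , xRy) ◅ y↠z , z≼u

  Reach-trans : ∀ {w v u} → Reach w v → Reach v u → Reach w u
  Reach-trans (_ , w↠x , x≼v) v⇝u =
    let _ , x↠y , y≼u = ≼-Reach x≼v v⇝u in _ , w↠x ◅◅ x↠y , y≼u

  R±⇒Reach : ∀ {x y} → R± x y → (Reach on proj₁) x y
  R±⇒Reach (narrow w↠v) = _ , Star-R⇒Star-≼;R w↠v , ≼.refl
  R±⇒Reach (wide w⇝v)   = w⇝v

  R±-refl : ∀ {x} → R± x x
  R±-refl {_ , false} = narrow ε
  R±-refl {_ , true}  = wide (_ , ε , ≼.refl)

  R±-trans : ∀ {x y z} → R± x y → R± y z → R± x z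
  R±-trans (narrow s) (narrow t) = narrow (s ◅◅ t)
  -- The second step may start from either copy; with copies forgotten it lies in `Reach` anyway.
  R±-trans (wide s)   t          = wide (Reach-trans s (R±⇒Reach t))

  ‖⊥‖-closed-Star : ∀ {w v} → w ∈ ‖⊥‖ → Star (_≼_ ; R) w v → v ∈ ‖⊥‖
  ‖⊥‖-closed-Star h ε = h
  ‖⊥‖-closed-Star h ((_ , w≼x , xRy) ◅ y↠v) =
    ‖⊥‖-closed-Star (‖⊥‖-closed (‖⊥‖-closed h (inj₁ w≼x)) (inj₂ xRy)) y↠v

  ‖⊥‖-closed-Reach : ∀ {w v} → w ∈ ‖⊥‖ → Reach w v → v ∈ ‖⊥‖
  ‖⊥‖-closed-Reach h (_ , w↠x , x≼v) = ‖⊥‖-closed (‖⊥‖-closed-Star h w↠x) (inj₁ x≼v)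

  splitFrame : CKFrame ℓ
  splitFrame = record
    { W            = W × Bool
    ; _≼_          = _≼_ on proj₁
    ; R            = R±
    ; ≼-isPreorder = record
      { isEquivalence = isEquivalence
      ; reflexive     = λ { refl → ≼.refl }
      ; trans         = ≼.trans
      }
    }

  split : CKModel _ ℓ
  split = record
    { frame        = splitFrame
    ; ‖⊥‖          = ‖⊥‖ ∘ proj₁
    ; ‖_‖          = λ q → ‖ q ‖ ∘ proj₁
    ; ‖⊥‖⊆‖_‖      = λ q → ‖⊥‖⊆‖_‖ q
    ; ‖_‖-monotone = λ q → ‖_‖-monotone q
    ; ‖⊥‖-closed   = λ h → [ ‖⊥‖-closed h ∘ inj₁ , ‖⊥‖-closed-Reach h ∘ R±⇒Reach ]
    ; ‖⊥‖-serial   = λ _ → _ , R±-refl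
    }

  split-isCS4 : IsCS4 split
  split-isCS4 = record
    { R-isPreorder = record
      { isEquivalence = isEquivalence
      ; reflexive     = λ { refl → R±-refl }
      ; trans         = R±-trans
      }
    -- The wide copy of `w` itself serves: the order ignores copies, and it sees `v′` whichever copy
    -- that is.
    ; confluent    = λ { {w , _} s v≼v′ →
        (w , true) , ≼.refl , wide (Reach-trans (R±⇒Reach s) (_ , ε , v≼v′)) }
    }

  -- The copy `i` stays arbitrary because the modal cases move between copies.
  split-⊩⇔⊩κ : ∀ {φ} → 𝓛 φ → ∀ w i → split , (w , i) ⊩ φ ⇔ M , w ⊩ κ φ
  split-⊩⇔⊩κ bot      w i = ⇔-refl
  split-⊩⇔⊩κ (atom q) w i = ⇔-refl
  split-⊩⇔⊩κ (a ∧ b)  w i = split-⊩⇔⊩κ a w i ×-⇔ split-⊩⇔⊩κ b w i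
  split-⊩⇔⊩κ (a ∨ b)  w i = split-⊩⇔⊩κ a w i ⊎-⇔ split-⊩⇔⊩κ b w i
  split-⊩⇔⊩κ (a ⇒ b)  w i = mk⇔
    (λ h v w≼v → to (split-⊩⇔⊩κ b v i) ∘ h (v , i) w≼v ∘ from (split-⊩⇔⊩κ a v i))
    (λ { h (v , j) w≼v → from (split-⊩⇔⊩κ b v j) ∘ h v w≼v ∘ to (split-⊩⇔⊩κ a v j) })
  split-⊩⇔⊩κ {□ φ} (□ a) w i = mk⇔
    (λ h v w↠v → to (split-⊩⇔⊩κ a v i)
      -- Passing to the wide copy of `w` makes the whole path a single `R±` step.
      (h (v , i) ((w , true) , ≼.refl , wide (v , w↠v , ≼.refl))))
    (λ { h (v , j) (_ , w≼x , xRv) →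
      -- The path covered by `□*` ends at `u`; monotonicity carries `κ φ` over the remaining `u≼v`.
      let u , w↠u , u≼v = ≼-Reach w≼x (R±⇒Reach xRv)
      in from (split-⊩⇔⊩κ a v j) (⊩-monotone M (κ φ) u≼v (h u w↠u)) })
  split-⊩⇔⊩κ {◇ φ} (◇ a) w i = mk⇔ narrow-witness any-witness
    where
    narrow-witness : split , (w , i) ⊩ ◇ φ → M , w ⊩ ◇* κ φ
    narrow-witness h v w≼v with h (v , false) w≼v
    -- Since `h` is queried at the narrow copy of `v`, only `narrow` can match, which yields a
    -- genuine `R`-path.
    ... | (u , false) , narrow v↠u , k = u , v↠u , to (split-⊩⇔⊩κ a u false) k

    any-witness : M , w ⊩ ◇* κ φ → split , (w , i) ⊩ ◇ φ
    any-witness h (v , false) w≼v =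
      let u , v↠u , k = h v w≼v
      in (u , false) , narrow v↠u , from (split-⊩⇔⊩κ a u false) k
    any-witness h (v , true) w≼v =
      let u , v↠u , k = h v w≼v
      in (u , false) , wide (u , Star-R⇒Star-≼;R v↠u , ≼.refl) , from (split-⊩⇔⊩κ a u false) k

open Split using (split; split-isCS4; split-⊩⇔⊩κ)

theorem7p7 : ∀ {p ℓ} {PV : Set p} (φ : Form PV) → 𝓛 φ →
    ((∀ (M : CKModel PV ℓ) → IsCS4 M → M ⊨ φ) ⇔ (∀ (M : CKModel PV ℓ) → M ⊨ κ φ))
    × ((∀ (M : CKModel PV ℓ) → IsWS4 M → M ⊨ φ) ⇔ (∀ (M : CKModel PV ℓ) → IsWK M → M ⊨ κ φ))
theorem7p7 φ a =
    mk⇔ (λ h M w → to (split-⊩⇔⊩κ M a w false) (h (split M) (split-isCS4 M) (w , false)))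
        (λ h M cs4 w → from (CS4-⊩⇔⊩κ M cs4 a w) (h M w))
  -- A fallible world of `split M` projects to a fallible world of `M`, so infallibility transfers.
  , mk⇔ (λ h M wk w → to (split-⊩⇔⊩κ M a w false)
          (h (split M) (split-isCS4 M , wk ∘ proj₁) (w , false)))
        (λ { h M (cs4 , wk) w → from (CS4-⊩⇔⊩κ M cs4 a w) (h M wk w) })
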